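{- Let $G$ be a connected graph with $\nu_s(G)\ge 2\Delta(G)$, where $\Delta(G)$ is the maximum degree of $G$. Then $\nu_s(G)=\nu_d(G)$ if and only if $G$ is a Cameron-Walker-graph.
   Context: All graphs are finite, simple and undirected. For a matching $M$ of $G$, $G[M]$ denotes the subgraph of $G$ induced by the set $V(M)$ of endpoints of edges of $M$. A matching $M$ is disconnected if $G[M]$ is disconnected or $M$ is empty; $\nu_d(G)$ is the maximum size of a disconnected matching of $G$. A matching $M$ is induced if $G[M]$ is $1$-regular or empty; $\nu_s(G)$ is the maximum size of an induced matching of $G$. A connected graph $G$ is a Cameron-Walker-graph if $V(G)$ is the disjoint union of four (possibly empty) sets $A,B,C,D$ such that: (i) all vertices in $A$ have degree $1$ in $G$; (ii) if $G[A\cup B]$ is non-empty, it is $1$-regular and bipartite with partition classes $A$ and $B$; (iii) $G[B\cup C]$ is bipartite with partition classes $B$ and $C$ (i.e. $B$ and $C$ are independent sets); (iv) if $G[D]$ is non-empty, it is $1$-regular, and for every edge $xy$ of $G[D]$ there exists $z\in C$ such that $N_G(x)\setminus\{y\}=N_G(y)\setminus\{x\}=\{z\}$. -}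

module Defs where

open import Data.Fin using (Fin; _≟_)
open import Data.Fin.Properties using (all?; any?)
open import Data.Fin.Subset
open import Data.Fin.Subset.Properties
  using (_∈?_; ∉⊥; nonempty?; ∣p∣≤n; p⊂q⇒∣p∣<∣q∣; x∈⁅x⁆; x∈p∩q⁺; x∈p∪q⁺; x∈p∪q⁻)
open import Data.List using (List; []; _∷_; length; map; allFin)
open import Data.List.Extrema.Nat using (max)
open import Data.List.Membership.Propositional using () renaming (_∈_ to _∈ˡ_)
open import Data.List.Membership.Propositional.Properties using (∈-allFin)
open import Data.List.Relation.Unary.All as All using (All; []; _∷_)
open import Data.List.Relation.Unary.AllPairs using (AllPairs; []; _∷_; allPairs?)
open import Data.List.Relation.Unary.Any using (here; there)
open import Data.Nat using (ℕ; zero; suc; _≤_; s≤s; z≤n)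
import Data.Nat.Properties as ℕ
open import Data.Product using (∃; ∃-syntax; _×_; _,_; proj₁; uncurry)
open import Data.Sum using (_⊎_; inj₁; inj₂)
open import Data.Vec using (tabulate)
open import Function using (_∘_)
open import Level using (0ℓ)
open import Relation.Binary using (Rel; Decidable; Symmetric; Irreflexive)
open import Relation.Binary.Construct.Closure.ReflexiveTransitive using (Star; ε; _◅_; _◅◅_)
open import Relation.Binary.PropositionalEquality using (_≡_; refl; cong)
open import Relation.Nullary using (¬_; Dec; yes; no; does; contradiction)
open import Relation.Nullary.Decidable using (map′; ¬?; _×-dec_; _⊎-dec_; _→-dec_)
open import Relation.Unary using (Pred) renaming (Decidable to Decidable₁)

-- Isomorphic graphs satisfy the same statements, so the vertices are
-- taken to be Fin n.
record Graph (n : ℕ) : Set₁ where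
  field
    Adj    : Rel (Fin n) 0ℓ
    adj?   : Decidable Adj
    sym    : Symmetric Adj
    irrefl : Irreflexive _≡_ Adj

Disjoint : ∀ {n} → Subset n → Subset n → Set
Disjoint p q = Empty (p ∩ q)

-- Reachability through a list of permitted intermediate vertices, as in
-- Warshall's algorithm; it decides the reflexive-transitive closure.
module Reachability {n} {R : Rel (Fin n) 0ℓ} (R? : Decidable R) where

  Via : List (Fin n) → Rel (Fin n) 0ℓ
  Via []       x y = x ≡ y ⊎ R x y
  Via (m ∷ ms) x y = Via ms x y ⊎ (Via ms x m × Via ms m y)

  via? : ∀ ms → Decidable (Via ms)
  via? []       x y = (x ≟ y) ⊎-dec R? x y
  via? (m ∷ ms) x y = via? ms x y ⊎-dec (via? ms x m ×-dec via? ms m y)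

  via-refl : ∀ ms {x} → Via ms x x
  via-refl []       = inj₁ refl
  via-refl (m ∷ ms) = inj₁ (via-refl ms)

  via-edge : ∀ ms {x y} → R x y → Via ms x y
  via-edge []       r = inj₂ r
  via-edge (m ∷ ms) r = inj₁ (via-edge ms r)

  via-trans : ∀ {ms i x y} → i ∈ˡ ms → Via ms x i → Via ms i y → Via ms x y
  via-trans (here refl) (inj₁ p)       (inj₁ q)       = inj₂ (p , q)
  via-trans (here refl) (inj₁ p)       (inj₂ (_ , q)) = inj₂ (p , q)
  via-trans (here refl) (inj₂ (p , _)) (inj₁ q)       = inj₂ (p , q)
  via-trans (here refl) (inj₂ (p , _)) (inj₂ (_ , q)) = inj₂ (p , q)
  via-trans (there i∈)  (inj₁ p)       (inj₁ q)       = inj₁ (via-trans i∈ p q)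
  via-trans (there i∈)  (inj₁ p)       (inj₂ (q , r)) = inj₂ (via-trans i∈ p q , r)
  via-trans (there i∈)  (inj₂ (p , q)) (inj₁ r)       = inj₂ (p , via-trans i∈ q r)
  via-trans (there i∈)  (inj₂ (p , _)) (inj₂ (_ , r)) = inj₂ (p , r)

  via⇒star : ∀ ms {x y} → Via ms x y → Star R x y
  via⇒star []       (inj₁ refl)    = ε
  via⇒star []       (inj₂ r)       = r ◅ ε
  via⇒star (m ∷ ms) (inj₁ p)       = via⇒star ms p
  via⇒star (m ∷ ms) (inj₂ (p , q)) = via⇒star ms p ◅◅ via⇒star ms q

  star⇒via : ∀ {x y} → Star R x y → Via (allFin n) x y
  star⇒via ε        = via-refl (allFin n)
  star⇒via (r ◅ rs) = via-trans (∈-allFin _) (via-edge (allFin n) r) (star⇒via rs)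

  star? : Decidable (Star R)
  star? x y = map′ (via⇒star (allFin n)) star⇒via (via? (allFin n) x y)

module _ {n} (G : Graph n) where
  open Graph G

  N : Fin n → Subset n
  N v = tabulate (does ∘ adj? v)

  degree : Fin n → ℕ
  degree v = ∣ N v ∣

  Δ : ℕ
  Δ = max 0 (map degree (allFin n))

  -- An induced subgraph G[S] is given by its vertex set S.

  AdjIn : Subset n → Rel (Fin n) 0ℓ
  AdjIn S u v = u ∈ S × v ∈ S × Adj u v

  ConnectedOn : Subset n → Set
  ConnectedOn S = ∀ u v → u ∈ S → v ∈ S → Star (AdjIn S) u v

  RegularOn : ℕ → Subset n → Set
  RegularOn k S = ∀ v → v ∈ S → ∣ N v ∩ S ∣ ≡ k

  Independent : Subset n → Set
  Independent S = ∀ u v → u ∈ S → v ∈ S → ¬ Adj u v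

  Connected : Set
  Connected = ConnectedOn ⊤

  ends : Fin n × Fin n → Subset n
  ends (u , v) = ⁅ u ⁆ ∪ ⁅ v ⁆

  -- Edges with pairwise disjoint ends are distinct, so the size of a
  -- matching is the length of any list of its edges; neither the order of
  -- the list nor the orientation of the pairs matters.
  IsMatching : List (Fin n × Fin n) → Set
  IsMatching M = All (uncurry Adj) M × AllPairs (λ e f → Disjoint (ends e) (ends f)) M

  V : List (Fin n × Fin n) → Subset n
  V M = ⋃ (map ends M)

  IsDisconnected : List (Fin n × Fin n) → Set
  IsDisconnected M = ¬ ConnectedOn (V M) ⊎ M ≡ []

  IsInduced : List (Fin n × Fin n) → Set
  IsInduced M = RegularOn 1 (V M) ⊎ M ≡ []

  IsMaximumSize : Pred (List (Fin n × Fin n)) 0ℓ → ℕ → Set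
  IsMaximumSize P k =
    (∃[ M ] IsMatching M × P M × length M ≡ k) ×
    (∀ M → IsMatching M → P M → length M ≤ k)

  isMatching? : Decidable₁ IsMatching
  isMatching? M =
    All.all? (uncurry adj?) M ×-dec
    allPairs? (λ e f → ¬? (nonempty? (ends e ∩ ends f))) M

  null? : Decidable₁ {A = List (Fin n × Fin n)} (_≡ [])
  null? []      = yes refl
  null? (_ ∷ _) = no λ ()

  connectedOn? : Decidable₁ ConnectedOn
  connectedOn? S = all? λ u → all? λ v →
    (u ∈? S) →-dec ((v ∈? S) →-dec Reachability.star? adjIn? u v)
    where
    adjIn? : Decidable (AdjIn S)
    adjIn? u v = (u ∈? S) ×-dec ((v ∈? S) ×-dec adj? u v)

  isDisconnected? : Decidable₁ IsDisconnected
  isDisconnected? M = ¬? (connectedOn? (V M)) ⊎-dec null? M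

  isInduced? : Decidable₁ IsInduced
  isInduced? M =
    (all? λ v → (v ∈? V M) →-dec (∣ N v ∩ V M ∣ ℕ.≟ 1)) ⊎-dec null? M

  matching≤n : ∀ M → IsMatching M → length M ≤ n
  matching≤n M (_ , dis) = ℕ.≤-trans (length≤ M dis) (∣p∣≤n (V M))
    where
    avoids : ∀ {u} e M → u ∈ ends e →
             All (λ f → Disjoint (ends e) (ends f)) M → u ∉ V M
    avoids e []      _   []       u∈V = ∉⊥ u∈V
    avoids e (f ∷ M) u∈e (d ∷ ds) u∈V with x∈p∪q⁻ (ends f) (V M) u∈V
    ... | inj₁ u∈f = d (_ , x∈p∩q⁺ (u∈e , u∈f))
    ... | inj₂ u∈M = avoids e M u∈e ds u∈M

    length≤ : ∀ M → AllPairs (λ e f → Disjoint (ends e) (ends f)) M →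
              length M ≤ ∣ V M ∣
    length≤ []              []        = z≤n
    length≤ (e@(u , v) ∷ M) (ds ∷ dis) =
      ℕ.≤-trans (s≤s (length≤ M dis))
        (p⊂q⇒∣p∣<∣q∣ ( (λ x∈ → x∈p∪q⁺ (inj₂ x∈))
                     , u , x∈p∪q⁺ (inj₁ u∈e) , avoids e M u∈e ds ))
      where
      u∈e : u ∈ ends e
      u∈e = x∈p∪q⁺ (inj₁ (x∈⁅x⁆ u))

  ofLength? : ∀ {Q : Pred (List (Fin n × Fin n)) 0ℓ} → Decidable₁ Q →
              ∀ k → Dec (∃[ M ] Q M × length M ≡ k)
  ofLength? Q? zero = map′ (λ q → [] , q , refl) (λ { ([] , q , _) → q }) (Q? [])
  ofLength? Q? (suc k) = map′
    (λ { (u , v , M , q , eq) → (u , v) ∷ M , q , cong suc eq })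
    (λ { ((u , v) ∷ M , q , eq) → u , v , M , q , ℕ.suc-injective eq })
    (any? λ u → any? λ v → ofLength? (λ M → Q? ((u , v) ∷ M)) k)

  maximumSize : ∀ {P : Pred (List (Fin n × Fin n)) 0ℓ} →
                Decidable₁ P → P [] → ∃ (IsMaximumSize P)
  maximumSize {P} P? P[] = search n matching≤n′
    where
    matching≤n′ : ∀ M → IsMatching M → P M → length M ≤ n
    matching≤n′ M m _ = matching≤n M m

    search : ∀ b → (∀ M → IsMatching M → P M → length M ≤ b) → ∃ (IsMaximumSize P)
    search zero bound = 0 , ([] , ([] , []) , P[] , refl) , bound
    search (suc b) bound
      with ofLength? (λ M → isMatching? M ×-dec P? M) (suc b)
    ... | yes (M , (m , p) , eq) = suc b , (M , m , p , eq) , bound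
    ... | no none = search b λ M m p →
      ℕ.≤-pred (ℕ.≤∧≢⇒< (bound M m p) λ eq → none (M , (m , p) , eq))

  maximumDisconnected : ∃ (IsMaximumSize IsDisconnected)
  maximumDisconnected = maximumSize isDisconnected? (inj₂ refl)

  maximumInduced : ∃ (IsMaximumSize IsInduced)
  maximumInduced = maximumSize isInduced? (inj₂ refl)

  νd : ℕ
  νd = proj₁ maximumDisconnected

  νs : ℕ
  νs = proj₁ maximumInduced

  record CameronWalker : Set where
    field
      connected : Connected
      A B C D   : Subset n
      disjoint  : AllPairs Disjoint (A ∷ B ∷ C ∷ D ∷ [])
      cover     : A ∪ B ∪ C ∪ D ≡ ⊤
      A-leaves  : ∀ v → v ∈ A → degree v ≡ 1
      AB-edges  : Nonempty (A ∪ B) →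
                  RegularOn 1 (A ∪ B) × Independent A × Independent B
      BC-bip    : Independent B × Independent C
      D-edges   : Nonempty D →
                  RegularOn 1 D ×
                  (∀ x y → x ∈ D → y ∈ D → Adj x y →
                   ∃[ z ] z ∈ C × N x - y ≡ ⁅ z ⁆ × N y - x ≡ ⁅ z ⁆)

{-# OPTIONS --safe #-}
-- If νs = νd = k ≥ 2Δ, let M be an induced matching of size k and U its vertex set.  A matching
-- of size k + 1 has a connected vertex set.  If it is M + xy, or M − uv + ux + vy, with x and y
-- outside U, then x or y must be adjacent to each of at least k − 1 edges of M, although only
-- 2Δ − 2 neighbours are available.  So the complement C of U is independent, and for each edge uv
-- of M either u or v is a leaf (this gives A and B) or both have the same single neighbour in C
-- (this gives D).  Conversely, in a Cameron–Walker graph the edges of G[A ∪ B ∪ D] form an induced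
-- matching, and every edge of any matching meets one of them in B ∪ D, no two meeting the same
-- one; hence νs = νd = ν.
module Submission where

open import Defs
open import Data.Nat using (ℕ; _*_; _≥_)
open import Function.Bundles using (_⇔_)
open import Relation.Binary.PropositionalEquality using (_≡_)

open import Data.Fin using (Fin; _≟_; _<_; _<?_)
open import Data.Fin.Properties using (all?; any?; <-cmp; <-asym; <-irrefl)
open import Data.Fin.Subset
open import Data.Fin.Subset.Properties
open import Data.List using (List; []; _∷_; _++_; length; filter; cartesianProduct; allFin)
open import Data.List.Extrema.Nat using (xs≤max)
open import Data.List.Membership.Propositional using () renaming (_∈_ to _∈ˡ_)
open import Data.List.Membership.Propositional.Properties
  using (∈-allFin; ∈-map⁺; ∈-∃++; ∈-cartesianProduct⁺; ∈-filter⁺)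
open import Data.List.Properties using (length-removeAt′)
open import Data.List.Relation.Binary.Permutation.Propositional using (_↭_; ↭⇒↭ₛ; ↭-sym)
open import Data.List.Relation.Binary.Permutation.Propositional.Properties
  using (shift; ↭-length; All-resp-↭; ∈-resp-↭)
import Data.List.Relation.Binary.Permutation.Setoid.Properties as ↭ₛ
open import Data.List.Relation.Unary.All as All using (All; []; _∷_)
open import Data.List.Relation.Unary.All.Properties using (all-filter)
open import Data.List.Relation.Unary.AllPairs as AllPairs using (AllPairs; []; _∷_)
import Data.List.Relation.Unary.AllPairs.Properties as AllPairs
open import Data.List.Relation.Unary.Any as Any using (Any; here; there)
open import Data.List.Relation.Unary.Unique.Propositional.Properties
  using (cartesianProduct⁺; allFin⁺)
open import Data.Nat using (suc; _+_; _≤_; z≤n; s≤s)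
import Data.Nat.Properties as ℕ
open import Data.Product using (∃-syntax; _×_; _,_; -,_; proj₁; proj₂; uncurry)
open import Data.Sum using (_⊎_; inj₁; inj₂; [_,_]′; map₁; map₂; swap)
open import Data.Vec using ([]; _∷_; tabulate)
open import Data.Vec.Properties using (lookup∘tabulate; []=⇒lookup; lookup⇒[]=)
open import Function using (_∘_; id)
open import Function.Bundles using (mk⇔)
open import Level using (0ℓ)
open import Relation.Binary using (tri<; tri≈; tri>)
open import Relation.Binary.Construct.Closure.ReflexiveTransitive using (Star; ε; _◅_)
open import Relation.Binary.PropositionalEquality
  using (_≢_; refl; sym; trans; cong; subst; setoid; resp₂)
open import Relation.Nullary using (¬_; yes; no; does; contradiction)
open import Relation.Nullary.Decidable using (dec-true; _×-dec_; _→-dec_; decidable-stable)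
open import Relation.Unary using (Pred) renaming (Decidable to Decidable₁)

-- Finite subsets, their sizes, and counting

private variable
  n : ℕ
  x y : Fin n
  p q : Subset n

module _ {P : Pred (Fin n) 0ℓ} (P? : Decidable₁ P) where

  ⟦_⟧ : Subset n
  ⟦_⟧ = tabulate (does ∘ P?)

  ∈⟦⟧⁺ : P x → x ∈ ⟦_⟧
  ∈⟦⟧⁺ {x} px =
    lookup⇒[]= x ⟦_⟧ (trans (lookup∘tabulate (does ∘ P?) x) (dec-true (P? x) px))

  ∈⟦⟧⁻ : x ∈ ⟦_⟧ → P x
  ∈⟦⟧⁻ {x} x∈ with P? x | trans (sym (lookup∘tabulate (does ∘ P?) x)) ([]=⇒lookup x∈)
  ... | yes px | _ = px
  ... | no _   | ()

∣p∪q∣≤∣p∣+∣q∣ : ∀ (p q : Subset n) → ∣ p ∪ q ∣ ≤ ∣ p ∣ + ∣ q ∣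
∣p∪q∣≤∣p∣+∣q∣ []            []            = z≤n
∣p∪q∣≤∣p∣+∣q∣ (outside ∷ p) (outside ∷ q) = ∣p∪q∣≤∣p∣+∣q∣ p q
∣p∪q∣≤∣p∣+∣q∣ (inside ∷ p)  (outside ∷ q) = s≤s (∣p∪q∣≤∣p∣+∣q∣ p q)
∣p∪q∣≤∣p∣+∣q∣ (outside ∷ p) (inside ∷ q)  =
  ℕ.≤-trans (s≤s (∣p∪q∣≤∣p∣+∣q∣ p q)) (ℕ.≤-reflexive (sym (ℕ.+-suc ∣ p ∣ ∣ q ∣)))
∣p∪q∣≤∣p∣+∣q∣ (inside ∷ p)  (inside ∷ q)  =
  s≤s (ℕ.≤-trans (∣p∪q∣≤∣p∣+∣q∣ p q) (ℕ.+-monoʳ-≤ ∣ p ∣ (ℕ.n≤1+n ∣ q ∣)))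

-- Removing `q` a second time changes nothing, whereas a common element would make `p ─ q` shrink
-- strictly.
x∈p─q⇒x∉q : x ∈ p ─ q → x ∉ q
x∈p─q⇒x∉q {p = p} {q} x∈ x∈q =
  ⊂-irref (p─q─q≡p─q p q) (p∩q≢∅⇒p─q⊂p (p ─ q) q (-, x∈p∩q⁺ (x∈ , x∈q)))

x∈p∧y∈p⇒x≡y : ∣ p ∣ ≡ 1 → x ∈ p → y ∈ p → x ≡ y
x∈p∧y∈p⇒x≡y {p = p} {x} {y} ∣p∣≡1 x∈p y∈p with x ≟ y
... | yes x≡y = x≡y
... | no  x≢y = contradiction
  (ℕ.<-≤-trans (s≤s (ℕ.≤-<-trans z≤n (x∈p⇒∣p-x∣<∣p∣ x∈p-y))) (x∈p⇒∣p-x∣<∣p∣ y∈p))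
  (ℕ.<-irrefl (sym ∣p∣≡1))
  where
  x∈p-y : x ∈ p - y
  x∈p-y = x∈p∧x≢y⇒x∈p-y x∈p x≢y

∣p∣≡1⇒Nonempty : ∣ p ∣ ≡ 1 → Nonempty p
∣p∣≡1⇒Nonempty {n} {p} ∣p∣≡1 with nonempty? p
... | yes ne = ne
... | no  em with trans (sym (∣⊥∣≡0 n)) (subst (λ r → ∣ r ∣ ≡ 1) (Empty-unique em) ∣p∣≡1)
...   | ()

singleton : x ∈ p → (∀ y → y ∈ p → y ≡ x) → p ≡ ⁅ x ⁆
singleton {x = x} {p} x∈p unique = ⊆-antisym
  (λ {y} y∈p → subst (_∈ ⁅ x ⁆) (sym (unique y y∈p)) (x∈⁅x⁆ x))
  (λ y∈ → subst (_∈ p) (sym (x∈⁅y⁆⇒x≡y x y∈)) x∈p)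

Disjoint-sym : Disjoint p q → Disjoint q p
Disjoint-sym {p = p} {q} d (x , x∈) = d (x , x∈p∩q⁺ (x∈q , x∈p))
  where
  x∈q = proj₂ (x∈p∩q⁻ q p x∈)
  x∈p = proj₁ (x∈p∩q⁻ q p x∈)

-- The partner of the first entry is deleted from `ys`; as no two entries share a partner, the later
-- entries keep theirs.
pigeonhole : ∀ {a b} {X : Set a} {Y : Set b} (T : X → Y → Set) {xs ys} →
             All (λ x → Any (T x) ys) xs →
             AllPairs (λ x x′ → ∀ y → T x y → ¬ T x′ y) xs →
             length xs ≤ length ys
pigeonhole T [] [] = z≤n
pigeonhole {X = X} {Y} T {x ∷ xs} {ys} (i ∷ is) (d ∷ ds) = ℕ.≤-trans
  (s≤s (pigeonhole T (All.zipWith (λ (d , j) → remove i d j) (d , is)) ds))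
  (ℕ.≤-reflexive (sym (length-removeAt′ ys (Any.index i))))
  where
  remove : ∀ {x x′ ys} (i : Any (T x) ys) → (∀ y → T x y → ¬ T x′ y) →
           Any (T x′) ys → Any (T x′) (ys Any.─ i)
  remove (here t)  d (here t′)  = contradiction t′ (d _ t)
  remove (here _)  _ (there j)  = j
  remove (there _) _ (here t′)  = here t′
  remove (there i) d (there j)  = there (remove i d j)

AllPairs-All : ∀ {a} {X : Set a} {P : Pred X 0ℓ} {R S : X → X → Set a} {xs} →
               (∀ {x y} → P x → P y → R x y → S x y) →
               All P xs → AllPairs R xs → AllPairs S xs
AllPairs-All f []         []         = []
AllPairs-All f (px ∷ pxs) (rs ∷ rss) =
  All.zipWith (λ (py , r) → f px py r) (pxs , rs) ∷ AllPairs-All f pxs rss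

-- Neighbours, edges and the vertex set of a matching

module _ {n} (G : Graph n) where
  open Graph G renaming (sym to adj-sym)

  private
    Edge = Fin n × Fin n
    variable
      a b c u v w : Fin n
      e f         : Edge
      M           : List Edge
      S Q         : Subset n

  adj⇒≢ : Adj a b → a ≢ b
  adj⇒≢ ab a≡b = irrefl a≡b ab

  ∈N⁺ : Adj a b → b ∈ N G a
  ∈N⁺ {a} = ∈⟦⟧⁺ (adj? a)

  ∈N⁻ : b ∈ N G a → Adj a b
  ∈N⁻ {a = a} = ∈⟦⟧⁻ (adj? a)

  ∈N-⁺ : Adj a c → c ≢ b → c ∈ N G a - b
  ∈N-⁺ ac = x∈p∧x≢y⇒x∈p-y (∈N⁺ ac)

  ∈N-⁻ : c ∈ N G a - b → Adj a c × c ≢ b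
  ∈N-⁻ {a = a} {b} c∈ =
    ∈N⁻ (p─q⊆p (N G a) ⁅ b ⁆ c∈) , λ { refl → x∈p─q⇒x∉q {p = N G a} c∈ (x∈⁅x⁆ b) }

  leaf-neighbour-unique : degree G a ≡ 1 → Adj a b → Adj a c → b ≡ c
  leaf-neighbour-unique d ab ac = x∈p∧y∈p⇒x≡y d (∈N⁺ ab) (∈N⁺ ac)

  degree≤Δ : ∀ v → degree G v ≤ Δ G
  degree≤Δ v = All.lookup (xs≤max 0 _) (∈-map⁺ (degree G) (∈-allFin v))

  left∈ends : u ∈ ends G (u , v)
  left∈ends {u} = x∈p∪q⁺ (inj₁ (x∈⁅x⁆ u))

  right∈ends : v ∈ ends G (u , v)
  right∈ends {v} = x∈p∪q⁺ (inj₂ (x∈⁅x⁆ v))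

  ∈ends⁻ : w ∈ ends G (u , v) → w ≡ u ⊎ w ≡ v
  ∈ends⁻ {u = u} {v} w∈ with x∈p∪q⁻ ⁅ u ⁆ ⁅ v ⁆ w∈
  ... | inj₁ w∈u = inj₁ (x∈⁅y⁆⇒x≡y u w∈u)
  ... | inj₂ w∈v = inj₂ (x∈⁅y⁆⇒x≡y v w∈v)

  -- Frees later arguments from the orientation in which `e` is stored.
  other-end : uncurry Adj e → a ∈ ends G e →
              ∃[ b ] Adj a b × b ∈ ends G e × (∀ {c} → c ∈ ends G e → c ≡ a ⊎ c ≡ b)
  other-end adj a∈ with ∈ends⁻ a∈
  ... | inj₁ refl = -, adj , right∈ends , ∈ends⁻
  ... | inj₂ refl = -, adj-sym adj , left∈ends , swap ∘ ∈ends⁻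

  ∈V⁺ : e ∈ˡ M → u ∈ ends G e → u ∈ V G M
  ∈V⁺ (here refl) u∈e = x∈p∪q⁺ (inj₁ u∈e)
  ∈V⁺ (there e∈M) u∈e = x∈p∪q⁺ (inj₂ (∈V⁺ e∈M u∈e))

  ∈V⁻ : ∀ M → u ∈ V G M → ∃[ e ] e ∈ˡ M × u ∈ ends G e
  ∈V⁻ []      u∈ = contradiction u∈ ∉⊥
  ∈V⁻ (e ∷ M) u∈ with x∈p∪q⁻ (ends G e) (V G M) u∈
  ... | inj₁ u∈e = e , here refl , u∈e
  ... | inj₂ u∈M with ∈V⁻ M u∈M
  ...   | f , f∈M , u∈f = f , there f∈M , u∈f

  DisjointEnds : Edge → Edge → Set
  DisjointEnds e f = Disjoint (ends G e) (ends G f)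

  ends-apart : All (DisjointEnds e) M → u ∈ ends G e → u ∉ V G M
  ends-apart {M = M} ds u∈e u∈F with ∈V⁻ M u∈F
  ... | f , f∈M , u∈f = All.lookup ds f∈M (-, x∈p∩q⁺ (u∈e , u∈f))

  apart-ends : u ∉ V G M → v ∉ V G M → All (DisjointEnds (u , v)) M
  apart-ends {u} {M} {v} u∉ v∉ = All.tabulate λ {f} f∈M (w , w∈) →
    let w∈uv , w∈f = x∈p∩q⁻ (ends G (u , v)) (ends G f) w∈ in
    [ (λ { refl → u∉ (∈V⁺ f∈M w∈f) }) , (λ { refl → v∉ (∈V⁺ f∈M w∈f) }) ]′ (∈ends⁻ w∈uv)

  -- Disjoint edges use different vertices of `P`: once the vertex `u` of the first edge is deleted,
  -- `P - u` still hits all the others.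
  hitting-set : ∀ P → AllPairs DisjointEnds M → All (λ e → Nonempty (ends G e ∩ P)) M →
                length M ≤ ∣ P ∣
  hitting-set P []       []                = z≤n
  hitting-set P (_∷_ {x = e} ds dss) ((u , u∈) ∷ hs) = ℕ.≤-trans
    (s≤s (hitting-set (P - u) dss (All.zipWith keep (ds , hs))))
    (x∈p⇒∣p-x∣<∣p∣ (proj₂ (x∈p∩q⁻ (ends G e) P u∈)))
    where
    keep : DisjointEnds e f × Nonempty (ends G f ∩ P) → Nonempty (ends G f ∩ (P - u))
    keep {f} (d , w , w∈) with x∈p∩q⁻ (ends G f) P w∈
    ... | w∈f , w∈P = w , x∈p∩q⁺ (w∈f , x∈p∧x≢y⇒x∈p-y w∈P λ { refl →
      d (w , x∈p∩q⁺ (proj₁ (x∈p∩q⁻ (ends G e) P u∈) , w∈f)) })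

  -- Disconnected and 1-regular induced subgraphs

  Closed : Subset n → Subset n → Set
  Closed Q S = ∀ {a c} → a ∈ Q → c ∈ S → Adj a c → c ∈ Q

  -- A walk in G[S] that starts in `Q` never leaves it; a closed `Q` inside `S` is a union of
  -- components of G[S].
  closed⇒disconnected : Closed Q S → a ∈ Q → a ∈ S → b ∈ S → b ∉ Q → ¬ ConnectedOn G S
  closed⇒disconnected {Q} {S} closed a∈Q a∈S b∈S b∉Q con = b∉Q (stays a∈Q (con _ _ a∈S b∈S))
    where
    stays : a ∈ Q → Star (AdjIn G S) a b → b ∈ Q
    stays a∈Q ε                     = a∈Q
    stays a∈Q ((_ , c∈S , ac) ◅ cs) = stays (closed a∈Q c∈S ac) cs

  matched-neighbour : RegularOn G 1 S → v ∈ S → ∃[ w ] w ∈ S × Adj v w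
  matched-neighbour {S} {v} reg v∈S with ∣p∣≡1⇒Nonempty (reg v v∈S)
  ... | w , w∈ with x∈p∩q⁻ (N G v) S w∈
  ...   | w∈N , w∈S = w , w∈S , ∈N⁻ w∈N

  matched-neighbour-unique : RegularOn G 1 S → v ∈ S → a ∈ S → b ∈ S →
                             Adj v a → Adj v b → a ≡ b
  matched-neighbour-unique {v = v} reg v∈S a∈S b∈S va vb =
    x∈p∧y∈p⇒x≡y (reg v v∈S) (x∈p∩q⁺ (∈N⁺ va , a∈S)) (x∈p∩q⁺ (∈N⁺ vb , b∈S))

  regular⁺ : (∀ v → v ∈ S → ∃[ w ] w ∈ S × Adj v w × (∀ {u} → u ∈ S → Adj v u → u ≡ w)) →
             RegularOn G 1 S
  regular⁺ {S} match v v∈S with match v v∈S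
  ... | w , w∈S , vw , unique = trans
    (cong ∣_∣ (singleton (x∈p∩q⁺ (∈N⁺ vw , w∈S)) λ u u∈ →
      let u∈N , u∈S = x∈p∩q⁻ (N G v) S u∈ in unique u∈S (∈N⁻ u∈N)))
    (∣⁅x⁆∣≡1 w)

  -- Uniqueness of the neighbour is inherited from `S`, so only its existence within `Q` has to be
  -- supplied.
  sub-regular : RegularOn G 1 S → Q ⊆ S → (∀ v → v ∈ Q → ∃[ w ] w ∈ Q × Adj v w) →
                RegularOn G 1 Q
  sub-regular reg Q⊆S match = regular⁺ λ v v∈Q → let w , w∈Q , vw = match v v∈Q in
    w , w∈Q , vw , λ u∈Q vu →
      matched-neighbour-unique reg (Q⊆S v∈Q) (Q⊆S u∈Q) (Q⊆S w∈Q) vu vw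

  -- The empty matching has no vertices, so regularity is vacuous there and the two cases of
  -- `IsInduced` become one.
  induced⇒regular : IsInduced G M → RegularOn G 1 (V G M)
  induced⇒regular (inj₁ reg)  = reg
  induced⇒regular (inj₂ refl) = λ v v∈ → contradiction v∈ ∉⊥

  -- The single neighbour of `a` in `V G M` is the other end of `e`, so each edge of an induced
  -- matching spans a component.
  induced-ends-closed : IsMatching G M → RegularOn G 1 (V G M) → e ∈ˡ M →
                        Closed (ends G e) (V G M)
  induced-ends-closed {e = e} (adj , _) reg e∈M a∈e c∈V ac
    with other-end (All.lookup adj e∈M) a∈e
  ... | b , ab , b∈e , _ = subst (_∈ ends G e)
    (matched-neighbour-unique reg (∈V⁺ e∈M a∈e) (∈V⁺ e∈M b∈e) c∈V ab ac) b∈e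

  regular⇒perfect-matching : RegularOn G 1 S → ∃[ M ] IsMatching G M × V G M ≡ S
  regular⇒perfect-matching {S} reg = M₀ , (adjs , disjoint) , ⊆-antisym V⊆S S⊆V
    where
    Ok : Pred Edge 0ℓ
    -- Requiring `u < v` admits each edge in one orientation only.
    Ok (u , v) = u < v × u ∈ S × v ∈ S × Adj u v

    ok? : Decidable₁ Ok
    ok? (u , v) = (u <? v) ×-dec ((u ∈? S) ×-dec ((v ∈? S) ×-dec adj? u v))

    pairs = cartesianProduct (allFin n) (allFin n)

    M₀ : List Edge
    M₀ = filter ok? pairs

    oks : All Ok M₀
    oks = all-filter ok? pairs

    adjs : All (uncurry Adj) M₀
    adjs = All.map (λ (_ , _ , _ , uv) → uv) oks

    shared-vertex : Ok e → Ok f → e ≢ f → DisjointEnds e f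
    shared-vertex {u , v} {u′ , v′} (u<v , u∈ , v∈ , uv) (u′<v′ , u′∈ , v′∈ , u′v′) e≢f (w , w∈)
      with x∈p∩q⁻ (ends G (u , v)) (ends G (u′ , v′)) w∈
    ... | w∈e , w∈f with ∈ends⁻ w∈e | ∈ends⁻ w∈f
    ... | inj₁ refl | inj₁ refl =
      e≢f (cong (u ,_) (matched-neighbour-unique reg u∈ v∈ v′∈ uv u′v′))
    ... | inj₂ refl | inj₂ refl =
      e≢f (cong (_, v) (matched-neighbour-unique reg v∈ u∈ u′∈ (adj-sym uv) (adj-sym u′v′)))
    -- In the two mixed cases one pair is the reverse of the other, which the increasing order rules
    -- out.
    ... | inj₁ refl | inj₂ refl
      with refl ← matched-neighbour-unique reg u∈ v∈ u′∈ uv (adj-sym u′v′) = <-asym u<v u′<v′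
    ... | inj₂ refl | inj₁ refl
      with refl ← matched-neighbour-unique reg v∈ u∈ v′∈ (adj-sym uv) u′v′ = <-asym u<v u′<v′

    disjoint : AllPairs DisjointEnds M₀
    disjoint = AllPairs-All shared-vertex oks
      (AllPairs.filter⁺ ok? (cartesianProduct⁺ (allFin⁺ n) (allFin⁺ n)))

    V⊆S : V G M₀ ⊆ S
    V⊆S x∈ with ∈V⁻ M₀ x∈
    ... | e , e∈M₀ , x∈e with All.lookup oks e∈M₀ | ∈ends⁻ x∈e
    ...   | _ , u∈ , _ , _ | inj₁ refl = u∈
    ...   | _ , _ , v∈ , _ | inj₂ refl = v∈

    ∈M₀ : Ok e → e ∈ˡ M₀
    ∈M₀ ok = ∈-filter⁺ ok? (∈-cartesianProduct⁺ (∈-allFin _) (∈-allFin _)) ok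

    S⊆V : S ⊆ V G M₀
    S⊆V {x} x∈ with matched-neighbour reg x∈
    ... | y , y∈ , xy with <-cmp x y
    ...   | tri< x<y _ _ = ∈V⁺ (∈M₀ (x<y , x∈ , y∈ , xy)) left∈ends
    ...   | tri≈ _ x≡y _ = contradiction xy (irrefl x≡y)
    ...   | tri> _ _ y<x = ∈V⁺ (∈M₀ (y<x , y∈ , x∈ , adj-sym xy)) right∈ends

  -- The partition obtained from a maximum induced matching

  module MaximumInduced {M} (m : IsMatching G M) (reg : RegularOn G 1 (V G M))
    (big : 2 * Δ G ≤ length M)
    (max : ∀ M′ → IsMatching G M′ → ¬ ConnectedOn G (V G M′) → length M′ ≤ length M)
    where

    -- If F is almost all of M, then one of its edges has no neighbour among x and y, because
    -- these have at most 2Δ − 2 neighbours besides s and t; so M′ is disconnected.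
    no-larger-matching : ∀ M′ F {x y s t} →
      IsMatching G M′ → suc (length M) ≤ length M′ →
      AllPairs DisjointEnds F → (∀ {e} → e ∈ˡ F → e ∈ˡ M) → (∀ {e} → e ∈ˡ F → e ∈ˡ M′) →
      length M ≤ suc (length F) →
      (∀ {c} → c ∈ V G M′ → c ∈ V G M ⊎ c ≡ x ⊎ c ≡ y) →
      x ∈ V G M′ → x ∉ V G F → Adj x s → Adj y t → s ∉ V G F → ¬ (t ∉ V G F)
    no-larger-matching M′ F {x} {y} {s} {t} m′ larger dis F⊆M F⊆M′ almost V′ x∈ x∉F xs yt s∉F t∉F =
      -- `too-many` bounds `length F` by 2Δ - 2, while `big` and `almost` make it at least 2Δ - 1.
      ℕ.<-irrefl refl (ℕ.≤-trans too-many (ℕ.≤-trans big almost))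
      where
      P = (N G x - s) ∪ (N G y - t)

      hit : f ∈ˡ F → Nonempty (ends G f ∩ P)
      hit {f} f∈F = decidable-stable (nonempty? (ends G f ∩ P)) λ missed →
        -- If `f` misses `P`, its ends are closed in `V G M′` and do not include `x`, so `M′` is
        -- disconnected and `max` contradicts `larger`.
        ℕ.<⇒≱ larger (max M′ m′ (closed⇒disconnected (closed missed) left∈ends
          (∈V⁺ (F⊆M′ f∈F) left∈ends) x∈ (x∉F ∘ ∈V⁺ f∈F)))
        where
        closed : ¬ Nonempty (ends G f ∩ P) → Closed (ends G f) (V G M′)
        closed missed {a} a∈f c∈ ac with V′ c∈
        ... | inj₁ c∈M = induced-ends-closed m reg (F⊆M f∈F) a∈f c∈M ac
        ... | inj₂ (inj₁ refl) = contradiction (a , x∈p∩q⁺ (a∈f , x∈p∪q⁺ (inj₁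
          (∈N-⁺ (adj-sym ac) λ { refl → s∉F (∈V⁺ f∈F a∈f) })))) missed
        ... | inj₂ (inj₂ refl) = contradiction (a , x∈p∩q⁺ (a∈f , x∈p∪q⁺ (inj₂
          (∈N-⁺ (adj-sym ac) λ { refl → t∉F (∈V⁺ f∈F a∈f) })))) missed

      few : Adj a b → suc ∣ N G a - b ∣ ≤ Δ G
      few {a} ab = ℕ.≤-trans (x∈p⇒∣p-x∣<∣p∣ (∈N⁺ ab)) (degree≤Δ a)

      too-many : suc (suc (length F)) ≤ 2 * Δ G
      too-many = begin
        suc (suc (length F))                        ≤⟨ s≤s (s≤s (hitting-set P dis (All.tabulate hit))) ⟩
        suc (suc ∣ P ∣)                             ≤⟨ s≤s (s≤s (∣p∪q∣≤∣p∣+∣q∣ (N G x - s) (N G y - t))) ⟩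
        suc (suc (∣ N G x - s ∣ + ∣ N G y - t ∣))   ≡⟨ cong suc (ℕ.+-suc ∣ N G x - s ∣ ∣ N G y - t ∣) ⟨
        suc ∣ N G x - s ∣ + suc ∣ N G y - t ∣       ≤⟨ ℕ.+-mono-≤ (few xs) (few yt) ⟩
        Δ G + Δ G                                   ≡⟨ cong (Δ G +_) (ℕ.+-identityʳ (Δ G)) ⟨
        2 * Δ G                                     ∎
        where open ℕ.≤-Reasoning

    U : Subset n
    U = V G M

    -- The larger matching is `M` with xy added. Here `F` is all of `M`, and the neighbours
    -- discounted for `x` and `y` are `y` and `x`.
    outside-independent : x ∉ U → y ∉ U → ¬ Adj x y
    outside-independent {x} {y} x∉ y∉ xy = no-larger-matching ((x , y) ∷ M) M
      (xy ∷ proj₁ m , apart-ends x∉ y∉ ∷ proj₂ m) ℕ.≤-refl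
      (proj₂ m) id there (ℕ.n≤1+n _)
      (λ c∈ → [ inj₂ ∘ ∈ends⁻ , inj₁ ]′ (x∈p∪q⁻ (ends G (x , y)) U c∈))
      (x∈p∪q⁺ (inj₁ left∈ends)) x∉ xy (adj-sym xy) y∉ x∉

    -- Otherwise uv could be replaced by ux and vy.
    same-outside-neighbour : (u , v) ∈ˡ M → x ∉ U → y ∉ U → Adj u x → Adj v y → x ≡ y
    same-outside-neighbour {u} {v} {x} {y} uv∈M x∉ y∉ ux vy with x ≟ y
    ... | yes x≡y = x≡y
    ... | no  x≢y with ∈-∃++ uv∈M
    ...   | ys , zs , refl = contradiction m₀ not-matching
      where
      F = ys ++ zs

      perm : M ↭ (u , v) ∷ F
      perm = shift (u , v) ys zs

      m₀ : IsMatching G ((u , v) ∷ F)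
      m₀ = All-resp-↭ perm (proj₁ m) ,
           ↭ₛ.AllPairs-resp-↭ (setoid Edge) (λ {e} {f} → Disjoint-sym {p = ends G e} {ends G f})
             (resp₂ DisjointEnds) (↭⇒↭ₛ perm) (proj₂ m)

      F⊆M : e ∈ˡ F → e ∈ˡ M
      F⊆M = ∈-resp-↭ (↭-sym perm) ∘ there

      VF⊆U : V G F ⊆ U
      VF⊆U c∈ with ∈V⁻ F c∈
      ... | e , e∈F , c∈e = ∈V⁺ (F⊆M e∈F) c∈e

      -- Stated as a refutation of `m₀` so that matching on its argument yields `ds`, which
      -- separates uv from `F`.
      not-matching : ¬ IsMatching G ((u , v) ∷ F)
      -- `F` has one edge less than `M`, and two edges replace uv. The neighbours discounted for `x`
      -- and `y` are `u` and `v`, which lie off `F`.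
      not-matching (uv ∷ adjs , ds ∷ dss) = no-larger-matching ((u , x) ∷ (v , y) ∷ F) F
        ( ux ∷ vy ∷ adjs
        , (ux-vy ∷ apart-ends u∉F x∉F) ∷ apart-ends v∉F y∉F ∷ dss)
        (ℕ.≤-reflexive (cong suc (↭-length perm)))
        dss F⊆M (there ∘ there) (ℕ.≤-reflexive (↭-length perm))
        cover (x∈p∪q⁺ (inj₁ right∈ends)) x∉F (adj-sym ux) (adj-sym vy) u∉F v∉F
        where
        u∈U : u ∈ U
        u∈U = ∈V⁺ uv∈M left∈ends

        v∈U : v ∈ U
        v∈U = ∈V⁺ uv∈M right∈ends

        u∉F = ends-apart ds left∈ends
        v∉F = ends-apart ds right∈ends
        x∉F = x∉ ∘ VF⊆U
        y∉F = y∉ ∘ VF⊆U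

        ux-vy : DisjointEnds (u , x) (v , y)
        ux-vy (w , w∈) with x∈p∩q⁻ (ends G (u , x)) (ends G (v , y)) w∈
        ... | w∈ux , w∈vy with ∈ends⁻ w∈ux | ∈ends⁻ w∈vy
        ...   | inj₁ refl | inj₁ w≡v  = adj⇒≢ uv w≡v
        ...   | inj₁ refl | inj₂ refl = y∉ u∈U
        ...   | inj₂ refl | inj₁ refl = x∉ v∈U
        ...   | inj₂ refl | inj₂ w≡y  = x≢y w≡y

        cover : c ∈ V G ((u , x) ∷ (v , y) ∷ F) → c ∈ U ⊎ c ≡ x ⊎ c ≡ y
        cover c∈ with x∈p∪q⁻ (ends G (u , x)) _ c∈
        ... | inj₁ c∈ux = [ (λ { refl → inj₁ u∈U }) , inj₂ ∘ inj₁ ]′ (∈ends⁻ c∈ux)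
        ... | inj₂ c∈′ with x∈p∪q⁻ (ends G (v , y)) (V G F) c∈′
        ...   | inj₁ c∈vy = [ (λ { refl → inj₁ v∈U }) , inj₂ ∘ inj₂ ]′ (∈ends⁻ c∈vy)
        ...   | inj₂ c∈F  = inj₁ (VF⊆U c∈F)

    -- By regularity `a` and `b` are the ends of an edge of `M`, stored as ab or as ba; the second
    -- case swaps the roles of `x` and `y`.
    common-outside-neighbour : a ∈ U → b ∈ U → Adj a b →
                               x ∉ U → y ∉ U → Adj a x → Adj b y → x ≡ y
    common-outside-neighbour a∈ b∈ ab x∉ y∉ ax by with ∈V⁻ M a∈
    ... | (u , v) , uv∈M , a∈uv with All.lookup (proj₁ m) uv∈M | ∈ends⁻ a∈uv
    ...   | uv | inj₁ refl
      with refl ← matched-neighbour-unique reg a∈ b∈ (∈V⁺ uv∈M right∈ends) ab uv =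
      same-outside-neighbour uv∈M x∉ y∉ ax by
    ...   | uv | inj₂ refl
      with refl ← matched-neighbour-unique reg a∈ b∈ (∈V⁺ uv∈M left∈ends) ab (adj-sym uv) =
      sym (same-outside-neighbour uv∈M y∉ x∉ by ax)

    -- The order on the vertices breaks the tie when both ends of an edge are leaves.
    ChosenLeaf : Pred (Fin n) 0ℓ
    ChosenLeaf u =
      u ∈ U × degree G u ≡ 1 × (∀ w → w ∈ U → Adj u w → degree G w ≡ 1 → u < w)

    chosenLeaf? : Decidable₁ ChosenLeaf
    chosenLeaf? u = (u ∈? U) ×-dec ((degree G u ℕ.≟ 1) ×-dec all? λ w →
      (w ∈? U) →-dec (adj? u w →-dec ((degree G w ℕ.≟ 1) →-dec (u <? w))))

    A : Subset n
    A = ⟦ chosenLeaf? ⟧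

    ∈A⁻ : a ∈ A → ChosenLeaf a
    ∈A⁻ = ∈⟦⟧⁻ chosenLeaf?

    A⊆U : A ⊆ U
    A⊆U = proj₁ ∘ ∈A⁻

    leafMate? : Decidable₁ (λ w → ∃[ u ] u ∈ A × Adj u w)
    leafMate? w = any? λ u → (u ∈? A) ×-dec adj? u w

    B : Subset n
    B = ⟦ leafMate? ⟧

    ∈B⁺ : a ∈ A → Adj a b → b ∈ B
    ∈B⁺ a∈A ab = ∈⟦⟧⁺ leafMate? (-, a∈A , ab)

    ∈B⁻ : b ∈ B → ∃[ a ] a ∈ A × Adj a b
    ∈B⁻ = ∈⟦⟧⁻ leafMate?

    -- The only neighbour of a leaf in `U` is its partner in `M`.
    B⊆U : B ⊆ U
    B⊆U b∈ with ∈B⁻ b∈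
    ... | a , a∈A , ab with matched-neighbour reg (A⊆U a∈A)
    ...   | b′ , b′∈U , ab′ =
      subst (_∈ U) (leaf-neighbour-unique (proj₁ (proj₂ (∈A⁻ a∈A))) ab′ ab) b′∈U

    C : Subset n
    C = ∁ U

    D : Subset n
    D = U ─ (A ∪ B)

    ∈D⁺ : v ∈ U → v ∉ A → v ∉ B → v ∈ D
    ∈D⁺ v∈U v∉A v∉B = x∈p∧x∉q⇒x∈p─q v∈U ([ v∉A , v∉B ]′ ∘ x∈p∪q⁻ A B)

    D⊆U : D ⊆ U
    D⊆U = p─q⊆p U (A ∪ B)

    ∈D⇒∉A∪B : v ∈ D → v ∉ A ∪ B
    ∈D⇒∉A∪B v∈D v∈AB = x∈p─q⇒x∉q v∈D v∈AB

    -- Of two adjacent chosen leaves, each would precede the other.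
    A-independent : Independent G A
    A-independent u w u∈ w∈ uw with ∈A⁻ u∈ | ∈A⁻ w∈
    ... | u∈U , du , u-min | w∈U , dw , w-min =
      <-asym (u-min w w∈U uw dw) (w-min u u∈U (adj-sym uw) du)

    A-B-disjoint : v ∈ A → v ∉ B
    A-B-disjoint v∈A v∈B with ∈B⁻ v∈B
    ... | a , a∈A , av = A-independent a _ a∈A v∈A av

    -- The partner of `b` in `U` is unique, hence it is the leaf that put `b` into `B`.
    B-matched-in-A : b ∈ B → v ∈ U → Adj b v → v ∈ A
    B-matched-in-A b∈B v∈U bv with ∈B⁻ b∈B
    ... | a , a∈A , ab = subst (_∈ A)
      (matched-neighbour-unique reg (B⊆U b∈B) (A⊆U a∈A) v∈U (adj-sym ab) bv) a∈A

    B-independent : Independent G B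
    B-independent u w u∈ w∈ uw = A-B-disjoint (B-matched-in-A u∈ (B⊆U w∈) uw) w∈

    AB-regular : RegularOn G 1 (A ∪ B)
    AB-regular = sub-regular reg ([ A⊆U , B⊆U ]′ ∘ x∈p∪q⁻ A B) match
      where
      match : ∀ v → v ∈ A ∪ B → ∃[ w ] w ∈ A ∪ B × Adj v w
      match v v∈ with x∈p∪q⁻ A B v∈
      ... | inj₁ v∈A with matched-neighbour reg (A⊆U v∈A)
      ...   | w , _ , vw = w , x∈p∪q⁺ (inj₂ (∈B⁺ v∈A vw)) , vw
      match v v∈ | inj₂ v∈B with ∈B⁻ v∈B
      ...   | a , a∈A , av = a , x∈p∪q⁺ (inj₁ a∈A) , adj-sym av

    D-regular : RegularOn G 1 D
    D-regular = sub-regular reg D⊆U match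
      where
      match : ∀ v → v ∈ D → ∃[ w ] w ∈ D × Adj v w
      match v v∈D with matched-neighbour reg (D⊆U v∈D)
      -- A partner in `A` would put `v` into `B`, and a partner in `B` would put `v` into `A`.
      ... | w , w∈U , vw = w , ∈D⁺ w∈U
        (λ w∈A → ∈D⇒∉A∪B v∈D (x∈p∪q⁺ (inj₂ (∈B⁺ w∈A (adj-sym vw)))))
        (λ w∈B → ∈D⇒∉A∪B v∈D (x∈p∪q⁺ (inj₁ (B-matched-in-A w∈B (D⊆U v∈D) (adj-sym vw)))))
        , vw

    -- If `x` were a leaf, then `x`, or `y` when it is a leaf too and precedes `x`, would have been
    -- chosen for `A`.
    D-nonleaf : x ∈ D → y ∈ D → Adj x y → degree G x ≢ 1
    D-nonleaf {x} {y} x∈D y∈D xy dx = x∉A compare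
      where
      x∈U = D⊆U x∈D
      y∈U = D⊆U y∈D

      x∉A : ¬ (∀ w → w ∈ U → Adj x w → degree G w ≡ 1 → x < w)
      x∉A least =
        ∈D⇒∉A∪B x∈D (x∈p∪q⁺ (inj₁ (∈⟦⟧⁺ chosenLeaf? (x∈U , dx , least))))

      compare : ∀ w → w ∈ U → Adj x w → degree G w ≡ 1 → x < w
      compare w w∈U xw dw with leaf-neighbour-unique dx xw xy
      ... | refl with <-cmp x y
      ...   | tri< x<y _ _ = x<y
      ...   | tri≈ _ x≡y _ = contradiction xy (irrefl x≡y)
      ...   | tri> _ _ y<x = contradiction
        (x∈p∪q⁺ (inj₁ (∈⟦⟧⁺ chosenLeaf? (y∈U , dw , least)))) (∈D⇒∉A∪B y∈D)
        where
        least : ∀ v → v ∈ U → Adj y v → degree G v ≡ 1 → y < v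
        least v _ yv _ with leaf-neighbour-unique dw yv (adj-sym xy)
        ... | refl = y<x

    -- Otherwise `y` would be the only neighbour of `x`, making `x` a leaf.
    D-outside-neighbour : x ∈ D → y ∈ D → Adj x y → ∃[ z ] z ∈ N G x - y
    D-outside-neighbour {x} {y} x∈D y∈D xy with nonempty? (N G x - y)
    ... | yes ne = ne
    ... | no  em = contradiction degree≡1 (D-nonleaf x∈D y∈D xy)
      where
      only : ∀ w → w ∈ N G x → w ≡ y
      only w w∈ = decidable-stable (w ≟ y) λ w≢y → em (w , x∈p∧x≢y⇒x∈p-y w∈ w≢y)

      degree≡1 : degree G x ≡ 1
      degree≡1 = trans (cong ∣_∣ (singleton (∈N⁺ xy) only)) (∣⁅x⁆∣≡1 y)

    outside-U : a ∈ U → b ∈ U → Adj a b → x ∈ N G a - b → x ∉ U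
    outside-U a∈ b∈ ab x∈ x∈U with ∈N-⁻ x∈
    ... | ax , x≢b = x≢b (matched-neighbour-unique reg a∈ x∈U b∈ ax ab)

    -- Both neighbour sets are nonempty and lie outside `U`, and every element of one equals every
    -- element of the other; so they are the same singleton.
    D-triangle : x ∈ D → y ∈ D → Adj x y →
                 ∃[ z ] z ∈ C × N G x - y ≡ ⁅ z ⁆ × N G y - x ≡ ⁅ z ⁆
    D-triangle {x} {y} x∈D y∈D xy
      with D-outside-neighbour x∈D y∈D xy | D-outside-neighbour y∈D x∈D (adj-sym xy)
    ... | z , z∈ | z′ , z′∈ = z , x∉p⇒x∈∁p (outside-U x∈U y∈U xy z∈) ,
      singleton z∈ (λ w w∈ → trans (same w∈ z′∈) (sym (same z∈ z′∈))) ,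
      subst (λ v → N G y - x ≡ ⁅ v ⁆) (sym (same z∈ z′∈))
        (singleton z′∈ λ w w∈ → trans (sym (same z∈ w∈)) (same z∈ z′∈))
      where
      x∈U = D⊆U x∈D
      y∈U = D⊆U y∈D

      same : a ∈ N G x - y → b ∈ N G y - x → a ≡ b
      same a∈ b∈ = common-outside-neighbour x∈U y∈U xy
        (outside-U x∈U y∈U xy a∈) (outside-U y∈U x∈U (adj-sym xy) b∈)
        (proj₁ (∈N-⁻ a∈)) (proj₁ (∈N-⁻ b∈))

    cameronWalker : Connected G → CameronWalker G
    cameronWalker con = record
      { connected = con
      ; A = A ; B = B ; C = C ; D = D
      ; disjoint =
          (disj A-B-disjoint ∷ disj (x∈p⇒x∉∁p ∘ A⊆U) ∷
           disj (λ a∈ d∈ → ∈D⇒∉A∪B d∈ (x∈p∪q⁺ (inj₁ a∈))) ∷ []) ∷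
          (disj (x∈p⇒x∉∁p ∘ B⊆U) ∷
           disj (λ b∈ d∈ → ∈D⇒∉A∪B d∈ (x∈p∪q⁺ (inj₂ b∈))) ∷ []) ∷
          (disj (λ c∈ d∈ → x∈∁p⇒x∉p c∈ (D⊆U d∈)) ∷ []) ∷ [] ∷ []
      ; cover = ⊆-antisym ⊆⊤ λ {v} _ → covered v
      ; A-leaves = λ v v∈A → proj₁ (proj₂ (∈A⁻ v∈A))
      ; AB-edges = λ _ → AB-regular , A-independent , B-independent
      ; BC-bip = B-independent , λ u v u∈ v∈ →
          outside-independent (x∈∁p⇒x∉p u∈) (x∈∁p⇒x∉p v∈)
      ; D-edges = λ _ → D-regular , λ _ _ → D-triangle
      }
      where
      disj : (∀ {x} → x ∈ p → x ∉ q) → Disjoint p q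
      disj {p = p} {q} d (x , x∈) with x∈p∩q⁻ p q x∈
      ... | x∈p , x∈q = d x∈p x∈q

      covered : ∀ v → v ∈ A ∪ B ∪ C ∪ D
      covered v with v ∈? A | v ∈? B | v ∈? U
      ... | yes v∈A | _       | _       = x∈p∪q⁺ (inj₁ v∈A)
      ... | no _    | yes v∈B | _       = x∈p∪q⁺ (inj₂ (x∈p∪q⁺ (inj₁ v∈B)))
      ... | no _    | no _    | no v∉U  =
        x∈p∪q⁺ (inj₂ (x∈p∪q⁺ (inj₂ (x∈p∪q⁺ (inj₁ (x∉p⇒x∈∁p v∉U))))))
      ... | no v∉A  | no v∉B  | yes v∈U =
        x∈p∪q⁺ (inj₂ (x∈p∪q⁺ (inj₂ (x∈p∪q⁺ (inj₂ (∈D⁺ v∈U v∉A v∉B))))))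

  -- A single edge is excluded by size: it forces Δ ≥ 1 and hence at least two edges. With two
  -- edges, the ends of the first are closed and miss the second.
  induced⇒disconnected : IsMatching G M → RegularOn G 1 (V G M) → 2 * Δ G ≤ length M →
                         IsDisconnected G M
  induced⇒disconnected {[]} _ _ _ = inj₂ refl
  induced⇒disconnected {(u , v) ∷ []} (uv ∷ [] , _) _ big =
    contradiction (ℕ.≤-trans (ℕ.*-monoʳ-≤ 2 Δ≥1) big) λ { (s≤s ()) }
    where
    Δ≥1 : 1 ≤ Δ G
    Δ≥1 = ℕ.≤-trans (ℕ.≤-trans (s≤s z≤n) (x∈p⇒∣p-x∣<∣p∣ (∈N⁺ uv))) (degree≤Δ u)
  induced⇒disconnected {e ∷ f ∷ M} m@(_ , (d ∷ _) ∷ _) reg _ = inj₁ (closed⇒disconnected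
    (induced-ends-closed m reg (here refl)) left∈ends (x∈p∪q⁺ (inj₁ left∈ends))
    (x∈p∪q⁺ (inj₂ (x∈p∪q⁺ (inj₁ left∈ends)))) λ u∈e → d (-, x∈p∩q⁺ (u∈e , left∈ends)))

  -- Maximum matchings of Cameron-Walker graphs

  module _ (cw : CameronWalker G) where
    open CameronWalker cw

    private
      apart : Disjoint p q → x ∈ p → x ∉ q
      apart d x∈p x∈q = d (-, x∈p∩q⁺ (x∈p , x∈q))

    AC-disjoint : x ∈ A → x ∉ C
    AC-disjoint with (_ ∷ ac ∷ _) ∷ _ ← disjoint = apart ac

    AD-disjoint : x ∈ A → x ∉ D
    AD-disjoint with (_ ∷ _ ∷ ad ∷ _) ∷ _ ← disjoint = apart ad

    BC-disjoint : x ∈ B → x ∉ C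
    BC-disjoint with _ ∷ (bc ∷ _) ∷ _ ← disjoint = apart bc

    BD-disjoint : x ∈ B → x ∉ D
    BD-disjoint with _ ∷ (_ ∷ bd ∷ _) ∷ _ ← disjoint = apart bd

    -- The vertex `v` itself discharges the nonemptiness condition of `AB-edges`.
    AB-matched : RegularOn G 1 (A ∪ B)
    AB-matched v v∈ = proj₁ (AB-edges (v , v∈)) v v∈

    D-matched : RegularOn G 1 D
    D-matched v v∈ = proj₁ (D-edges (v , v∈)) v v∈

    -- The only neighbour of the leaf `a` is its partner in G[A ∪ B], and `A` is independent.
    A-neighbour∈B : a ∈ A → Adj a b → b ∈ B
    A-neighbour∈B {a} a∈A ab with matched-neighbour AB-matched (x∈p∪q⁺ (inj₁ a∈A))
    ... | w , w∈ , aw with leaf-neighbour-unique (A-leaves a a∈A) aw ab | x∈p∪q⁻ A B w∈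
    ...   | refl | inj₂ w∈B = w∈B
    ...   | refl | inj₁ w∈A =
      contradiction aw (proj₁ (proj₂ (AB-edges (-, w∈))) a w a∈A w∈A)

    D-apex : x ∈ D → y ∈ D → Adj x y →
             ∃[ z ] z ∈ C × (∀ {c} → Adj x c → c ≡ y ⊎ c ≡ z) × (∀ {c} → Adj y c → c ≡ x ⊎ c ≡ z)
    D-apex {x} {y} x∈D y∈D xy with proj₂ (D-edges (x , x∈D)) x y x∈D y∈D xy
    ... | z , z∈C , Nx , Ny = z , z∈C , neighbour Nx , neighbour Ny
      where
      neighbour : N G a - b ≡ ⁅ z ⁆ → Adj a c → c ≡ b ⊎ c ≡ z
      neighbour {a} {b} {c} eq ac with c ≟ b
      ... | yes c≡b = inj₁ c≡b
      ... | no  c≢b = inj₂ (x∈⁅y⁆⇒x≡y z (subst (c ∈_) eq (∈N-⁺ ac c≢b)))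

    D-neighbour : x ∈ D → Adj x c → c ∈ D ⊎ c ∈ C
    D-neighbour x∈D xc with matched-neighbour D-matched x∈D
    ... | y , y∈D , xy with D-apex x∈D y∈D xy
    ...   | z , z∈C , Nx , _ =
      [ (λ { refl → inj₁ y∈D }) , (λ { refl → inj₂ z∈C }) ]′ (Nx xc)

    -- Neighbours of `D` lie in `D` or are an apex in `C`, and both sets are disjoint from `A` and
    -- `B`.
    AB-D-nonadjacent : x ∈ A ∪ B → y ∈ D → ¬ Adj x y
    AB-D-nonadjacent x∈AB y∈D xy with D-neighbour y∈D (adj-sym xy) | x∈p∪q⁻ A B x∈AB
    ... | inj₁ x∈D | inj₁ x∈A = AD-disjoint x∈A x∈D
    ... | inj₁ x∈D | inj₂ x∈B = BD-disjoint x∈B x∈D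
    ... | inj₂ x∈C | inj₁ x∈A = AC-disjoint x∈A x∈C
    ... | inj₂ x∈C | inj₂ x∈B = BC-disjoint x∈B x∈C

    -- The complement of `C`, which will be the vertex set of a maximum matching that is induced.
    core : Subset n
    core = (A ∪ B) ∪ D

    core-regular : RegularOn G 1 core
    core-regular = regular⁺ match
      where
      match : ∀ v → v ∈ core → ∃[ w ] w ∈ core × Adj v w × (∀ {u} → u ∈ core → Adj v u → u ≡ w)
      match v v∈ with x∈p∪q⁻ (A ∪ B) D v∈
      ... | inj₁ v∈AB with matched-neighbour AB-matched v∈AB
      ...   | w , w∈AB , vw = w , x∈p∪q⁺ (inj₁ w∈AB) , vw , λ u∈ vu →
        [ (λ u∈AB → matched-neighbour-unique AB-matched v∈AB u∈AB w∈AB vu vw)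
        , (λ u∈D → contradiction vu (AB-D-nonadjacent v∈AB u∈D))
        ]′ (x∈p∪q⁻ (A ∪ B) D u∈)
      match v v∈ | inj₂ v∈D with matched-neighbour D-matched v∈D
      ...   | w , w∈D , vw = w , x∈p∪q⁺ (inj₂ w∈D) , vw , λ u∈ vu →
        [ (λ u∈AB → contradiction (adj-sym vu) (AB-D-nonadjacent u∈AB v∈D))
        , (λ u∈D → matched-neighbour-unique D-matched v∈D u∈D w∈D vu vw)
        ]′ (x∈p∪q⁻ (A ∪ B) D u∈)

    -- So `B ∪ D` is a vertex cover: a leaf in `A` has its neighbour in `B`, and `C` is independent.
    edge-meets-B∪D : Adj a b → ∃[ w ] w ∈ ends G (a , b) × w ∈ B ∪ D
    edge-meets-B∪D {a} {b} ab with part a | part b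
      where
      part : ∀ v → v ∈ A ⊎ v ∈ C ⊎ v ∈ B ∪ D
      part v with x∈p∪q⁻ A (B ∪ C ∪ D) (subst (v ∈_) (sym cover) ∈⊤)
      ... | inj₁ v∈A = inj₁ v∈A
      ... | inj₂ v∈BCD with x∈p∪q⁻ B (C ∪ D) v∈BCD
      ...   | inj₁ v∈B = inj₂ (inj₂ (x∈p∪q⁺ (inj₁ v∈B)))
      ...   | inj₂ v∈CD = inj₂ (map₂ (x∈p∪q⁺ ∘ inj₂) (x∈p∪q⁻ C D v∈CD))
    ... | inj₂ (inj₂ a∈) | _              = a , left∈ends , a∈
    ... | _              | inj₂ (inj₂ b∈) = b , right∈ends , b∈
    ... | inj₁ a∈A       | _              = b , right∈ends , x∈p∪q⁺ (inj₁ (A-neighbour∈B a∈A ab))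
    ... | _              | inj₁ b∈A       =
      a , left∈ends , x∈p∪q⁺ (inj₁ (A-neighbour∈B b∈A (adj-sym ab)))
    ... | inj₂ (inj₁ a∈C) | inj₂ (inj₁ b∈C) = contradiction ab (proj₂ BC-bip a b a∈C b∈C)

    Meets : Edge → Edge → Set
    Meets e f = ∃[ w ] w ∈ ends G e × w ∈ ends G f × w ∈ B ∪ D

    -- Two disjoint edges through the two ends of an edge xy in D would both end at the apex.
    D-edge-met-once : uncurry Adj e → uncurry Adj f → x ∈ ends G e → y ∈ ends G f →
                      x ∈ D → y ∈ D → Adj x y → ¬ DisjointEnds e f
    D-edge-met-once {e} {f} {x} {y} ae af x∈e y∈f x∈D y∈D xy dis
      with D-apex x∈D y∈D xy | other-end ae x∈e | other-end af y∈f
    ... | z , _ , Nx , Ny | c , xc , c∈e , _ | d , yd , d∈f , _ with Nx xc | Ny yd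
    ...   | inj₁ refl | _         = dis (-, x∈p∩q⁺ (c∈e , y∈f))
    ...   | inj₂ _    | inj₁ refl = dis (-, x∈p∩q⁺ (x∈e , d∈f))
    ...   | inj₂ refl | inj₂ refl = dis (-, x∈p∩q⁺ (c∈e , d∈f))

    -- Disjoint `e` and `f` must meet `g` at different ends. As `B` is independent and not adjacent
    -- to `D`, both ends lie in `D`, where `D-edge-met-once` applies.
    met-once : ∀ {g} → uncurry Adj e → uncurry Adj f → uncurry Adj g → DisjointEnds e f →
               Meets e g → ¬ Meets f g
    met-once {e} {f} {g} ae af ag dis (x , x∈e , x∈g , x∈BD) (y , y∈f , y∈g , y∈BD)
      with other-end ag x∈g
    ... | w , xw , _ , only with only y∈g
    ...   | inj₁ refl = dis (-, x∈p∩q⁺ (x∈e , y∈f))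
    ...   | inj₂ refl with x∈p∪q⁻ B D x∈BD | x∈p∪q⁻ B D y∈BD
    ...     | inj₁ x∈B | inj₁ y∈B = proj₁ BC-bip x y x∈B y∈B xw
    ...     | inj₁ x∈B | inj₂ y∈D = AB-D-nonadjacent (x∈p∪q⁺ (inj₂ x∈B)) y∈D xw
    ...     | inj₂ x∈D | inj₁ y∈B = AB-D-nonadjacent (x∈p∪q⁺ (inj₂ y∈B)) x∈D (adj-sym xw)
    ...     | inj₂ x∈D | inj₂ y∈D = D-edge-met-once {e} {f} ae af x∈e y∈f x∈D y∈D xw dis

    maximum-matching-induced : ∃[ I ] IsMatching G I × RegularOn G 1 (V G I) ×
                               (∀ M → IsMatching G M → length M ≤ length I)
    maximum-matching-induced with regular⇒perfect-matching core-regular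
    ... | I , mI@(adjI , _) , VI≡core =
      I , mI , subst (RegularOn G 1) (sym VI≡core) core-regular , bound
      where
      -- Membership in `I` is part of the relation because `met-once` needs the common partner to be
      -- an edge of the graph.
      MeetsI : Edge → Edge → Set
      MeetsI e f = f ∈ˡ I × Meets e f

      meets : uncurry Adj e → Any (MeetsI e) I
      meets ae with edge-meets-B∪D ae
      ... | w , w∈e , w∈BD with ∈V⁻ I (subst (w ∈_) (sym VI≡core) (B∪D⊆core w∈BD))
        where
        B∪D⊆core : B ∪ D ⊆ core
        B∪D⊆core = x∈p∪q⁺ ∘ map₁ (x∈p∪q⁺ ∘ inj₂) ∘ x∈p∪q⁻ B D
      ...   | f , f∈I , w∈f = Any.map (λ { refl → f∈I , w , w∈e , w∈f , w∈BD }) f∈I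

      bound : ∀ M → IsMatching G M → length M ≤ length I
      bound M (adj , dis) = pigeonhole MeetsI (All.map meets adj)
        (AllPairs-All (λ {e} {f} ae af d g (g∈I , eg) (_ , fg) →
          met-once {e} {f} ae af (All.lookup adjI g∈I) d eg fg) adj dis)

-- Comparison of the two maxima

theorem25 : ∀ {n : ℕ} (G : Graph n) → Connected G → νs G ≥ 2 * Δ G →
    (νs G ≡ νd G) ⇔ CameronWalker G
theorem25 G con νs≥2Δ with maximumInduced G | maximumDisconnected G
... | k , (M , m , ind , refl) , s-max | l , (M′ , m′ , _ , refl) , d-max = mk⇔ to from
  where
  reg = induced⇒regular G ind

  to : length M ≡ length M′ → CameronWalker G
  to eq = MaximumInduced.cameronWalker G m reg νs≥2Δ
    (λ L mL dc → ℕ.≤-trans (d-max L mL (inj₁ dc)) (ℕ.≤-reflexive (sym eq))) con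

  from : CameronWalker G → length M ≡ length M′
  from cw with maximum-matching-induced G cw
  -- `M` is itself disconnected, so νs ≤ νd; and `I` is induced and bounds every matching, so νd ≤
  -- |I| ≤ νs.
  ... | I , mI , regI , I-max = ℕ.≤-antisym
    (d-max M m (induced⇒disconnected G m reg νs≥2Δ))
    (ℕ.≤-trans (I-max M′ m′) (s-max I mI (inj₁ regI)))
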